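{- Let $n \ge 1$ and $\ell \ge 2$ be integers, and let $x^0=(x^0_1,\dots,x^0_n)\in\mathbb{Z}^n$ satisfy $x^0_1\le\dots\le x^0_n$, have at least one entry that is a multiple of $\ell$, and satisfy $\mathrm{range}(x^0)\le \ell$. Let $x^0\to x^1\to\dots\to x^j\to\dots$ be the GM-sequence starting at $x^0$. Then for every $j\ge 0$, $\mathrm{pivot}(x^j)-\mathrm{pivot}(x^{j+\ell})\equiv 1 \pmod n$; that is, the pivot of $x^{j+\ell}$ is one less than the pivot of $x^j$, with the cyclic convention $1-1=0=n$.
   Context: Notation: $[n]=\{1,\dots,n\}$. Entries of vectors are integers and may be negative; $0$ and negative multiples count as multiples of $\ell$. For a vector with $x_1\le\dots\le x_n$, $\mathrm{range}(x)=x_n-x_1$. Pivot: let $x=(x_1,\dots,x_n)$ be an integer vector with $x_1\le \dots\le x_n$ having at least one entry that is a multiple of $\ell$. Among the entries of $x$ that are multiples of $\ell$, take the minimal value; the pivot of $x$, $\mathrm{pivot}(x)\in[n]$, is the largest index $i$ such that $x_i$ equals this value. GM-move: the GM-move $x\to x'$ keeps the pivotal entry ($x'_i=x_i$ for $i=\mathrm{pivot}(x)$) and reduces each of the other $n-1$ entries by $1$ ($x'_k=x_k-1$ for $k\ne i$). The vector $x'$ again satisfies $x'_1\le\dots\le x'_n$ and has an entry that is a multiple of $\ell$. The GM-sequence starting at $x^0$ is the infinite sequence $x^0\to x^1\to x^2\to\dots$ of successive GM-moves. -}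

module Defs where

open import Data.Bool.Base using (if_then_else_)
open import Data.Fin.Base as Fin using (Fin; zero; suc; toℕ; fromℕ)
import Data.Fin.Properties as Fin
open import Data.Integer.Base using (ℤ; +_; _-_; _≤_; 1ℤ; -1ℤ)
open import Data.Integer.Divisibility.Signed using (_∣_; _∣?_)
open import Data.Integer.Properties
  using (≤-refl; ≤-trans; ≤-reflexive; <⇒≤; <⇒≱; ≮⇒≥; _<?_; ≤-antisym;
         ≤∧≢⇒<; +-monoˡ-≤; i≤j⇒pred[i]≤j; i<j⇒i≤pred[j]; +-comm)
open import Data.Nat.Base as ℕ using (ℕ; zero; suc; z≤n; s≤s)
open import Data.Product.Base using (∃; _,_; proj₁; proj₂)
open import Data.Sum.Base using (_⊎_; inj₁; inj₂)
open import Data.Vec.Functional using (Vector; tail)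
open import Relation.Binary.Core using (_Preserves_⟶_)
open import Relation.Binary.PropositionalEquality
  using (_≡_; refl; sym; subst)
open import Relation.Nullary using (¬_; yes; no; does; contradiction)

infix 4 _≡_[mod_]

_≡_[mod_] : ℤ → ℤ → ℕ → Set
a ≡ b [mod n ] = + n ∣ a - b

Sorted : ∀ {n} → Vector ℤ n → Set
Sorted x = x Preserves Fin._≤_ ⟶ _≤_

HasMultiple : ∀ {n} → ℕ → Vector ℤ n → Set
HasMultiple ℓ x = ∃ λ i → + ℓ ∣ x i

range : ∀ {n} .{{_ : ℕ.NonZero n}} → Vector ℤ n → ℤ
range {suc m} x = x (fromℕ m) - x zero

record IsPivot {n} (ℓ : ℕ) (x : Vector ℤ n) (i : Fin n) : Set where
  field
    multiple : + ℓ ∣ x i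
    minimal  : ∀ k → + ℓ ∣ x k → x i ≤ x k
    largest  : ∀ k → x k ≡ x i → k Fin.≤ i

open IsPivot public

IsPivot-unique : ∀ {n ℓ} {x : Vector ℤ n} {i j} →
                 IsPivot ℓ x i → IsPivot ℓ x j → i ≡ j
IsPivot-unique {x = x} {i} {j} p q =
  Fin.≤-antisym (largest q i xi≡xj) (largest p j (sym xi≡xj))
  where
  xi≡xj : x i ≡ x j
  xi≡xj = ≤-antisym (minimal p j (multiple q)) (minimal q i (multiple p))

findPivot : ∀ {n} ℓ (x : Vector ℤ n) →
            ∃ (IsPivot ℓ x) ⊎ (∀ k → ¬ + ℓ ∣ x k)
findPivot {zero}  ℓ x = inj₂ λ ()
findPivot {suc n} ℓ x with findPivot ℓ (tail x) | + ℓ ∣? x zero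
... | inj₂ none | no ℓ∤x₀ = inj₂ λ where
  zero    → ℓ∤x₀
  (suc k) → none k
... | inj₂ none | yes ℓ∣x₀ = inj₁ (zero , record
  { multiple = ℓ∣x₀
  ; minimal  = λ where
      zero    _ → ≤-refl
      (suc k) d → contradiction d (none k)
  ; largest  = λ where
      zero    _  → z≤n
      (suc k) eq → contradiction (subst (+ ℓ ∣_) (sym eq) ℓ∣x₀) (none k)
  })
... | inj₁ (p , isP) | no ℓ∤x₀ = inj₁ (suc p , record
  { multiple = multiple isP
  ; minimal  = λ where
      zero    d → contradiction d ℓ∤x₀
      (suc k) d → minimal isP k d
  ; largest  = λ where
      zero    _  → z≤n
      (suc k) eq → s≤s (largest isP k eq)
  })
... | inj₁ (p , isP) | yes ℓ∣x₀ with x zero <? x (suc p)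
...   | yes x₀<xₚ = inj₁ (zero , record
  { multiple = ℓ∣x₀
  ; minimal  = λ where
      zero    _ → ≤-refl
      (suc k) d → ≤-trans (<⇒≤ x₀<xₚ) (minimal isP k d)
  ; largest  = λ where
      zero    _  → z≤n
      (suc k) eq → contradiction
        (≤-trans (minimal isP k (subst (+ ℓ ∣_) (sym eq) ℓ∣x₀)) (≤-reflexive eq))
        (<⇒≱ x₀<xₚ)
  })
...   | no  x₀≮xₚ = inj₁ (suc p , record
  { multiple = multiple isP
  ; minimal  = λ where
      zero    _ → ≮⇒≥ x₀≮xₚ
      (suc k) d → minimal isP k d
  ; largest  = λ where
      zero    _  → z≤n
      (suc k) eq → s≤s (largest isP k eq)
  })

record GMVector (ℓ n : ℕ) : Set where
  field
    entries     : Vector ℤ n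
    sorted      : Sorted entries
    hasMultiple : HasMultiple ℓ entries

open GMVector public

pivotExists : ∀ {ℓ n} (x : GMVector ℓ n) → ∃ (IsPivot ℓ (entries x))
pivotExists {ℓ} x with findPivot ℓ (entries x)
... | inj₁ p    = p
... | inj₂ none = contradiction (proj₂ (hasMultiple x)) (none (proj₁ (hasMultiple x)))

pivot : ∀ {ℓ n} → GMVector ℓ n → Fin n
pivot x = proj₁ (pivotExists x)

pivot-isPivot : ∀ {ℓ n} (x : GMVector ℓ n) → IsPivot ℓ (entries x) (pivot x)
pivot-isPivot x = proj₂ (pivotExists x)

-- The element of [n] = {1,…,n} named by i; Fin n itself counts from 0.
position : ∀ {n} → Fin n → ℤ
position i = + suc (toℕ i)

lowerExcept : ∀ {n} → Fin n → Vector ℤ n → Vector ℤ n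
lowerExcept i x k = if does (k Fin.≟ i) then x k else x k - 1ℤ

lowerExcept-sorted : ∀ {n ℓ} {x : Vector ℤ n} {i} →
                     Sorted x → IsPivot ℓ x i → Sorted (lowerExcept i x)
lowerExcept-sorted {x = x} {i} x↗ isP {a} {b} a≤b with a Fin.≟ i | b Fin.≟ i
... | yes _    | yes _ = x↗ a≤b
... | no  _    | no  _ = +-monoˡ-≤ -1ℤ (x↗ a≤b)
... | no  _    | yes _ = subst (_≤ x b) (+-comm -1ℤ (x a)) (i≤j⇒pred[i]≤j (x↗ a≤b))
... | yes refl | no b≢i = subst (x a ≤_) (+-comm -1ℤ (x b))
  (i<j⇒i≤pred[j] (≤∧≢⇒< (x↗ a≤b) λ eq →
    b≢i (Fin.≤-antisym (largest isP b (sym eq)) a≤b)))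

lowerExcept-fixed : ∀ {n} (i : Fin n) (x : Vector ℤ n) → lowerExcept i x i ≡ x i
lowerExcept-fixed i x with i Fin.≟ i
... | yes _  = refl
... | no i≢i = contradiction refl i≢i

gmMove : ∀ {ℓ n} → GMVector ℓ n → GMVector ℓ n
gmMove {ℓ} x = record
  { entries     = lowerExcept (pivot x) (entries x)
  ; sorted      = lowerExcept-sorted (sorted x) (pivot-isPivot x)
  ; hasMultiple = pivot x , subst (+ ℓ ∣_) (sym (lowerExcept-fixed (pivot x) (entries x)))
                                  (multiple (pivot-isPivot x))
  }

gmSequence : ∀ {ℓ n} → GMVector ℓ n → ℕ → GMVector ℓ n
gmSequence x⁰ zero    = x⁰
gmSequence x⁰ (suc j) = gmMove (gmSequence x⁰ j)

{-# OPTIONS --safe #-}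
-- Let n ≥ 2, let v be the pivotal value and q the cyclic predecessor of the pivot.
-- Put w = v if the pivot is the first entry (so that q is the last one) and w = v - ℓ
-- otherwise; in both cases w < x_q ≤ w + ℓ. Since q is not the pivot at the start, nor
-- while x_q lies strictly between the consecutive multiples w and w + ℓ of ℓ, x_q drops
-- by one at each move until it meets w, within ℓ moves. From the first move to the ℓ-th,
-- every entry stays above w - ℓ and every entry after q stays above w, because the old
-- pivotal entry has missed at least one of the decrements. Hence q becomes the pivot as
-- soon as x_q = w, and remains so until the ℓ-th move.
module Submission where

open import Defs
open import Data.Fin.Base as Fin using (Fin; zero; suc; fromℕ; inject₁)
import Data.Fin.Properties as Fin
open import Data.Integer.Base using (ℤ; +_; -_; _+_; _-_; _*_; _≤_; _<_; 0ℤ; 1ℤ; -1ℤ; +≤+; +<+)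
  renaming (suc to sucℤ)
open import Data.Integer.Divisibility.Signed using (_∣_; divides; ∣-refl; ∣m∣n⇒∣m-n)
open import Data.Integer.Properties
open import Data.Integer.Solver using (module +-*-Solver)
open import Data.Nat.Base as ℕ using (ℕ; NonZero; zero; suc; z≤n; s≤s)
import Data.Nat.Properties as ℕ
open import Data.Product.Base using (_×_; _,_)
open import Data.Sum.Base using (_⊎_; inj₁; inj₂)
open import Data.Vec.Functional using (Vector)
open import Relation.Binary.PropositionalEquality
  using (_≡_; _≢_; refl; sym; trans; cong; subst; ≢-sym)
open import Relation.Nullary using (Dec; yes; no; contradiction)

open +-*-Solver using (solve; con; _:+_; _:-_; _:*_; _:=_)

-- Integer inequalities and the spacing of multiples.

+-cancelˡ-≤ : ∀ i j k → i + j ≤ i + k → j ≤ k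
+-cancelˡ-≤ i j k i+j≤i+k = ≮⇒≥ λ k<j → <⇒≱ (+-monoʳ-< i k<j) i+j≤i+k

+-cancelˡ-< : ∀ i j k → i + j < i + k → j < k
+-cancelˡ-< i j k i+j<i+k = ≰⇒> λ k≤j → <⇒≱ i+j<i+k (+-monoʳ-≤ i k≤j)

add-minus : ∀ i j → i + (j - i) ≡ j
add-minus = solve 2 (λ i j → i :+ (j :- i) := j) refl

+-minus : ∀ i j → i + j - i ≡ j
+-minus = solve 2 (λ i j → i :+ j :- i := j) refl

-- Trades one unit of an entry for one elapsed move, so that drop bounds keep the additive form
-- `+ t + entry`.
+-suc-left : ∀ t i → + t + sucℤ i ≡ + suc t + i
+-suc-left t i = lemma (+ t) i
  where
  lemma : ∀ a i → a + (1ℤ + i) ≡ (1ℤ + a) + i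
  lemma = solve 2 (λ a i → a :+ (con 1ℤ :+ i) := (con 1ℤ :+ a) :+ i) refl

i<suc+i : ∀ t i → i < + suc t + i
i<suc+i t i = subst (_< + suc t + i) (+-identityˡ i) (+-monoˡ-< i (+<+ (s≤s z≤n)))

i-j≤k⇒i≤k+j : ∀ {i j k} → i - j ≤ k → i ≤ k + j
i-j≤k⇒i≤k+j {i} {j} i-j≤k = subst (_≤ _) (lemma i j) (+-monoˡ-≤ j i-j≤k)
  where
  lemma : ∀ i j → i - j + j ≡ i
  lemma = solve 2 (λ i j → i :- j :+ j := i) refl

i≤k+j⇒i-j≤k : ∀ {i j k} → i ≤ k + j → i - j ≤ k
i≤k+j⇒i-j≤k {i} {j} {k} i≤k+j = subst (i - j ≤_) (lemma k j) (+-monoˡ-≤ (- j) i≤k+j)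
  where
  lemma : ∀ k j → k + j - j ≡ k
  lemma = solve 2 (λ k j → k :+ j :- j := k) refl

∣∧<⇒+≤ : ∀ {ℓ a b} → + ℓ ∣ a → + ℓ ∣ b → a < b → + ℓ + a ≤ b
∣∧<⇒+≤ {ℓ} (divides p refl) (divides q refl) a<b =
  subst (_≤ q * + ℓ) (suc-* p (+ ℓ))
    (*-monoʳ-≤-nonNeg (+ ℓ) (i<j⇒suc[i]≤j (*-cancelʳ-<-nonNeg {p} {q} (+ ℓ) a<b)))

-- Change of single entries under moves.

lowerExcept-lowered : ∀ {n} {i k : Fin n} (x : Vector ℤ n) →
                      k ≢ i → sucℤ (lowerExcept i x k) ≡ x k
lowerExcept-lowered {i = i} {k} x k≢i with k Fin.≟ i
... | yes k≡i = contradiction k≡i k≢i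
... | no  _   = add-minus 1ℤ (x k)

module _ {ℓ n : ℕ} where

  gmMove-fixed : ∀ (x : GMVector ℓ n) {k} → pivot x ≡ k → entries (gmMove x) k ≡ entries x k
  gmMove-fixed x refl = lowerExcept-fixed (pivot x) (entries x)

  gmMove-lowered : ∀ (x : GMVector ℓ n) {k} → pivot x ≢ k →
                   sucℤ (entries (gmMove x) k) ≡ entries x k
  gmMove-lowered x p≢k = lowerExcept-lowered (entries x) (≢-sym p≢k)

  gmMove-drop : ∀ (x : GMVector ℓ n) k → entries x k ≤ sucℤ (entries (gmMove x) k)
  gmMove-drop x k with pivot x Fin.≟ k
  ... | yes p≡k = i≤j⇒i≤1+j (≤-reflexive (sym (gmMove-fixed x p≡k)))
  ... | no  p≢k = ≤-reflexive (sym (gmMove-lowered x p≢k))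

  gmSequence-+ : ∀ (x : GMVector ℓ n) j t →
                 gmSequence (gmSequence x j) t ≡ gmSequence x (j ℕ.+ t)
  gmSequence-+ x j zero    = cong (gmSequence x) (sym (ℕ.+-identityʳ j))
  gmSequence-+ x j (suc t) = trans (cong gmMove (gmSequence-+ x j t))
                                   (cong (gmSequence x) (sym (ℕ.+-suc j t)))

  gmSequence-drop : ∀ (x : GMVector ℓ n) k t →
                    entries x k ≤ + t + entries (gmSequence x t) k
  gmSequence-drop x k zero    = ≤-reflexive (sym (+-identityˡ _))
  gmSequence-drop x k (suc t) = begin
    entries x k               ≤⟨ gmSequence-drop x k t ⟩
    + t + entries y k         ≤⟨ +-monoʳ-≤ (+ t) (gmMove-drop y k) ⟩
    + t + sucℤ (entries y′ k) ≡⟨ +-suc-left t (entries y′ k) ⟩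
    + suc t + entries y′ k    ∎
    where
    open ≤-Reasoning
    y y′ : GMVector ℓ n
    y  = gmSequence x t
    y′ = gmMove y

  -- The first move keeps the old pivotal entry and each later one lowers it by at most one; hence
  -- the strictness.
  gmSequence-drop-pivot : ∀ (x : GMVector ℓ n) {p} → pivot x ≡ p → ∀ t →
                          entries x p < + suc t + entries (gmSequence x (suc t)) p
  gmSequence-drop-pivot x {p} eq zero    =
    subst (λ i → entries x p < 1ℤ + i) (sym (gmMove-fixed x eq)) (i<suc+i 0 _)
  gmSequence-drop-pivot x {p} eq (suc t) = begin-strict
    entries x p                   <⟨ gmSequence-drop-pivot x eq t ⟩
    + suc t + entries y p         ≤⟨ +-monoʳ-≤ (+ suc t) (gmMove-drop y p) ⟩
    + suc t + sucℤ (entries y′ p) ≡⟨ +-suc-left (suc t) (entries y′ p) ⟩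
    + suc (suc t) + entries y′ p  ∎
    where
    open ≤-Reasoning
    y y′ : GMVector ℓ n
    y  = gmSequence x (suc t)
    y′ = gmMove y

  -- A multiple of `ℓ` below `w` would be at most `w - ℓ`, which the bound on all entries excludes;
  -- the bound on later entries excludes a later occurrence of `w`.
  pivot-criterion : ∀ (z : GMVector ℓ n) {q w} → + ℓ ∣ w → w ≡ entries z q →
                    (∀ k → w < + ℓ + entries z k) →
                    (∀ {k} → q Fin.< k → w < entries z k) →
                    pivot z ≡ q
  pivot-criterion z {q} ℓ∣w refl low high = IsPivot-unique (pivot-isPivot z) record
    { multiple = ℓ∣w
    ; minimal  = λ k ℓ∣zk → ≮⇒≥ λ zk<w → <⇒≱ (low k) (∣∧<⇒+≤ ℓ∣zk ℓ∣w zk<w)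
    ; largest  = λ k zk≡w → ℕ.≮⇒≥ λ q<k → <-irrefl (sym zk≡w) (high q<k)
    }

  -- Descent of one entry to a multiple.

  module _ (x : GMVector ℓ n) {q : Fin n} {w : ℤ} (ℓ∣w : + ℓ ∣ w)
           (p≢q : pivot x ≢ q) (w<xq : w < entries x q) (xq≤ℓ+w : entries x q ≤ + ℓ + w)
           (low  : ∀ {t} → t ℕ.< ℓ → ∀ k → w < + ℓ + entries (gmSequence x (suc t)) k)
           (high : ∀ {t} → t ℕ.< ℓ → ∀ {k} → q Fin.< k → w < entries (gmSequence x (suc t)) k)
           where

    private
      z : ℕ → Vector ℤ n
      z t = entries (gmSequence x t)

      -- Either `w` has been reached, or every move so far has lowered entry `q`, as the second
      -- bound records. At `t = ℓ` that bound forces `z t q ≤ w`, so only the first alternative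
      -- survives.
      Approach : ℕ → Set
      Approach t = w ≡ z t q ⊎ (w < z t q × + t + z t q ≤ + ℓ + w)

      descend : ∀ {t} → pivot (gmSequence x t) ≢ q → w < z t q → + t + z t q ≤ + ℓ + w →
                Approach (suc t)
      descend {t} p≢q′ w<z bound with w ≟ z (suc t) q
      ... | yes w≡z′ = inj₁ w≡z′
      ... | no  w≢z′ = inj₂ (≤∧≢⇒< w≤z′ w≢z′ , subst (_≤ + ℓ + w) shift bound)
        where
        lowered : sucℤ (z (suc t) q) ≡ z t q
        lowered = gmMove-lowered (gmSequence x t) p≢q′

        w≤z′ : w ≤ z (suc t) q
        w≤z′ = +-cancelˡ-≤ 1ℤ _ _ (subst (sucℤ w ≤_) (sym lowered) (i<j⇒suc[i]≤j w<z))

        shift : + t + z t q ≡ + suc t + z (suc t) q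
        shift = trans (cong (λ i → + t + i) (sym lowered)) (+-suc-left t (z (suc t) q))

      reached⇒pivot : ∀ {t} → t ℕ.< ℓ → w ≡ z (suc t) q → pivot (gmSequence x (suc t)) ≡ q
      reached⇒pivot {t} t<ℓ w≡z =
        pivot-criterion (gmSequence x (suc t)) ℓ∣w w≡z (low t<ℓ) (high t<ℓ)

      approach : ∀ t → t ℕ.< ℓ → Approach (suc t)
      -- At the start entry `q` may equal the multiple `ℓ + w`, so the bound alone does not stop `q`
      -- from being the pivot; `p≢q` does.
      approach zero    _ = descend {0} p≢q w<xq (subst (_≤ + ℓ + w) (sym (+-identityˡ _)) xq≤ℓ+w)
      approach (suc t) t<ℓ with approach t (ℕ.<⇒≤ t<ℓ)
      -- Having reached `w`, `q` is the pivot, so the next move keeps its entry.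
      ... | inj₁ w≡z = inj₁ (trans w≡z (sym
              (gmMove-fixed (gmSequence x (suc t)) (reached⇒pivot (ℕ.<⇒≤ t<ℓ) w≡z))))
      ... | inj₂ (w<z , bound) = descend notPivot w<z bound
        where
        notPivot : pivot (gmSequence x (suc t)) ≢ q
        -- A pivotal entry would be a multiple above `w`, hence at least `ℓ + w`, but the moves
        -- already made have brought it strictly below that.
        notPivot refl = <⇒≱ (i<suc+i t _)
          (≤-trans bound (∣∧<⇒+≤ ℓ∣w (multiple (pivot-isPivot (gmSequence x (suc t)))) w<z))

    pivot-after-turn : ∀ {t} → suc t ≡ ℓ → pivot (gmSequence x (suc t)) ≡ q
    pivot-after-turn {t} refl with approach t ℕ.≤-refl
    ... | inj₁ w≡z           = reached⇒pivot ℕ.≤-refl w≡z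
    ... | inj₂ (w<z , bound) = contradiction (+-cancelˡ-≤ (+ ℓ) _ _ bound) (<⇒≱ w<z)

-- Preservation of the range bound.

spread≤ : ∀ {ℓ m} (x : GMVector ℓ (suc m)) → range (entries x) ≤ + ℓ →
          ∀ i k → entries x i ≤ + ℓ + entries x k
spread≤ {ℓ} {m} x r i k = begin
  entries x i               ≤⟨ sorted x (Fin.≤fromℕ i) ⟩
  entries x (fromℕ m)       ≤⟨ i-j≤k⇒i≤k+j r ⟩
  + ℓ + entries x zero      ≤⟨ +-monoʳ-≤ (+ ℓ) (sorted x z≤n) ⟩
  + ℓ + entries x k         ∎
  where open ≤-Reasoning

-- The range can grow only when the last entry is pivotal and the first is not; it then grows by
-- one, but was strictly less than `ℓ` before.
gmMove-range : ∀ {ℓ m} .{{_ : NonZero ℓ}} (x : GMVector ℓ (suc m)) →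
               range (entries x) ≤ + ℓ → range (entries (gmMove x)) ≤ + ℓ
gmMove-range {ℓ@(suc l)} {m} x r =
  i≤k+j⇒i-j≤k (bound (pivot x Fin.≟ fromℕ m) (pivot x Fin.≟ zero))
  where
  y : Vector ℤ (suc m)
  y = entries (gmMove x)

  L : Fin (suc m)
  L = fromℕ m

  bound : Dec (pivot x ≡ L) → Dec (pivot x ≡ zero) → y L ≤ + ℓ + y zero
  bound (no p≢L) _ = +-cancelˡ-≤ 1ℤ _ _ (begin
    sucℤ (y L)               ≡⟨ gmMove-lowered x p≢L ⟩
    entries x L              ≤⟨ spread≤ x r L zero ⟩
    + ℓ + entries x zero     ≤⟨ +-monoʳ-≤ (+ ℓ) (gmMove-drop x zero) ⟩
    + ℓ + sucℤ (y zero)      ≡⟨ +-suc-left ℓ (y zero) ⟩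
    + suc ℓ + y zero         ≡⟨ +-assoc 1ℤ (+ ℓ) (y zero) ⟩
    sucℤ (+ ℓ + y zero)      ∎)
    where open ≤-Reasoning
  bound (yes p≡L) (yes p≡0) = begin
    y L                      ≡⟨ cong y (trans (sym p≡L) p≡0) ⟩
    y zero                   ≤⟨ <⇒≤ (i<suc+i l _) ⟩
    + ℓ + y zero             ∎
    where open ≤-Reasoning
  bound (yes p≡L) (no p≢0) = +-cancelˡ-≤ 1ℤ _ _ (begin
    sucℤ (y L)               ≡⟨ cong sucℤ (gmMove-fixed x p≡L) ⟩
    sucℤ (entries x L)       ≤⟨ i<j⇒suc[i]≤j (≤∧≢⇒< (spread≤ x r L zero) unattained) ⟩
    + ℓ + entries x zero     ≡⟨ cong (λ i → + ℓ + i) (gmMove-lowered x p≢0) ⟨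
    + ℓ + sucℤ (y zero)      ≡⟨ +-suc-left ℓ (y zero) ⟩
    + suc ℓ + y zero         ≡⟨ +-assoc 1ℤ (+ ℓ) (y zero) ⟩
    sucℤ (+ ℓ + y zero)      ∎)
    where
    open ≤-Reasoning
    isP : IsPivot ℓ (entries x) L
    isP = subst (IsPivot ℓ (entries x)) p≡L (pivot-isPivot x)

    -- Equality would make the first entry a multiple of ℓ below the pivotal one.
    unattained : entries x L ≢ + ℓ + entries x zero
    unattained eq = <⇒≱ (subst (entries x zero <_) (sym eq) (i<suc+i l _))
      (minimal isP zero (subst (+ ℓ ∣_) (+-minus (+ ℓ) (entries x zero))
        (∣m∣n⇒∣m-n (subst (+ ℓ ∣_) eq (multiple isP)) ∣-refl)))

gmSequence-range : ∀ {ℓ m} .{{_ : NonZero ℓ}} (x : GMVector ℓ (suc m)) →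
                   range (entries x) ≤ + ℓ → ∀ j → range (entries (gmSequence x j)) ≤ + ℓ
gmSequence-range x r zero    = r
gmSequence-range x r (suc j) = gmMove-range (gmSequence x j) (gmSequence-range x r j)

-- Cyclic predecessors of positions.

cyclicPred : ∀ {m} → Fin (suc m) → Fin (suc m)
cyclicPred {m} zero    = fromℕ m
cyclicPred     (suc i) = inject₁ i

position-cyclicPred : ∀ {m} (i : Fin (suc m)) →
                      position i - position (cyclicPred i) ≡ 1ℤ [mod suc m ]
-- Wrap-around: with `n = suc m`, `1 - n - 1` is `-1` times `n`.
position-cyclicPred {m} zero rewrite Fin.toℕ-fromℕ m = divides -1ℤ (lemma (+ suc m))
  where
  lemma : ∀ a → 1ℤ - a - 1ℤ ≡ -1ℤ * a
  lemma = solve 1 (λ a → con 1ℤ :- a :- con 1ℤ := con -1ℤ :* a) refl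
position-cyclicPred {m} (suc i) rewrite Fin.toℕ-inject₁ i = divides 0ℤ (lemma (position i) (+ suc m))
  where
  lemma : ∀ a b → (1ℤ + a) - a - 1ℤ ≡ 0ℤ * b
  lemma = solve 2 (λ a b → (con 1ℤ :+ a) :- a :- con 1ℤ := con 0ℤ :* b) refl

-- One turn of `ℓ` moves.

pivot-turn : ∀ {ℓ m} .{{_ : NonZero ℓ}} (x : GMVector ℓ (suc m)) → range (entries x) ≤ + ℓ →
             pivot (gmSequence x ℓ) ≡ cyclicPred (pivot x)
-- A lone index is its own cyclic predecessor, so the descent, which needs `q` to differ from the
-- pivot, does not apply.
pivot-turn {m = zero} x r = Fin1-unique _ _
  where
  Fin1-unique : (i j : Fin 1) → i ≡ j
  Fin1-unique zero zero = refl
pivot-turn {ℓ@(suc l)} {m@(suc _)} x r with pivot x in eq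
... | zero  = pivot-after-turn x (multiple isP) p≢L
        (≤∧≢⇒< (sorted x z≤n) x₀≢xL) (spread≤ x r L zero)
        low (λ _ L<k → contradiction (Fin.≤fromℕ _) (ℕ.<⇒≱ L<k)) refl
  where
  L : Fin (suc m)
  L = fromℕ m

  isP : IsPivot ℓ (entries x) zero
  isP = subst (IsPivot ℓ (entries x)) eq (pivot-isPivot x)

  p≢L : pivot x ≢ L
  p≢L p≡L with () ← trans (sym eq) p≡L

  x₀≢xL : entries x zero ≢ entries x L
  -- The pivot is the largest index of its value, so equality would put the last index at or before
  -- the first.
  x₀≢xL x₀≡xL with () ← largest isP L (sym x₀≡xL)

  low : ∀ {t} → t ℕ.< ℓ → ∀ k → entries x zero < + ℓ + entries (gmSequence x (suc t)) k
  low {t} t<ℓ k = <-≤-trans (gmSequence-drop-pivot x eq t)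
    (+-mono-≤ (+≤+ t<ℓ) (sorted (gmSequence x (suc t)) {zero} {k} z≤n))
... | suc i = pivot-after-turn x ℓ∣w p≢q (w<x (inject₁ i))
        (subst (entries x (inject₁ i) ≤_) (sym ℓ+w≡v) (sorted x (ℕ.<⇒≤ q<p)))
        low high refl
  where
  isP : IsPivot ℓ (entries x) (suc i)
  isP = subst (IsPivot ℓ (entries x)) eq (pivot-isPivot x)

  q<p : inject₁ i Fin.< Fin.suc i
  q<p = Fin.≤̄⇒inject₁< Fin.≤-refl

  p≢q : pivot x ≢ inject₁ i
  p≢q p≡q = Fin.<⇒≢ q<p (trans (sym p≡q) eq)

  v w : ℤ
  v = entries x (suc i)
  w = v - + ℓ

  ℓ∣w : + ℓ ∣ w
  ℓ∣w = ∣m∣n⇒∣m-n (multiple isP) ∣-refl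

  ℓ+w≡v : + ℓ + w ≡ v
  ℓ+w≡v = add-minus (+ ℓ) v

  w<v : w < v
  w<v = subst (w <_) ℓ+w≡v (i<suc+i l w)

  -- The range bound gives `w ≤ entries x k`; equality would yield a multiple of `ℓ` below the
  -- pivotal value.
  w<x : ∀ k → w < entries x k
  w<x k = ≤∧≢⇒< (+-cancelˡ-≤ (+ ℓ) _ _ (subst (_≤ + ℓ + entries x k) (sym ℓ+w≡v)
                                        (spread≤ x r (suc i) k)))
                (λ w≡xk → <⇒≱ (subst (_< v) w≡xk w<v)
                              (minimal isP k (subst (+ ℓ ∣_) w≡xk ℓ∣w)))

  low : ∀ {t} → t ℕ.< ℓ → ∀ k → w < + ℓ + entries (gmSequence x (suc t)) k
  low {t} t<ℓ k = begin-strict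
    w                                          <⟨ w<x k ⟩
    entries x k                                ≤⟨ gmSequence-drop x k (suc t) ⟩
    + suc t + entries (gmSequence x (suc t)) k ≤⟨ +-monoˡ-≤ (entries (gmSequence x (suc t)) k) (+≤+ t<ℓ) ⟩
    + ℓ + entries (gmSequence x (suc t)) k     ∎
    where open ≤-Reasoning

  -- Indices after `q` start at the old pivot, whose entry loses less than `ℓ` by the `ℓ`-th move
  -- and so stays above `w = v - ℓ`; sortedness extends this to later entries.
  high : ∀ {t} → t ℕ.< ℓ → ∀ {k} → inject₁ i Fin.< k → w < entries (gmSequence x (suc t)) k
  high {t} t<ℓ {k} q<k = +-cancelˡ-< (+ ℓ) _ _ (begin-strict
    + ℓ + w                                           ≡⟨ ℓ+w≡v ⟩
    v                                                 <⟨ gmSequence-drop-pivot x eq t ⟩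
    + suc t + entries (gmSequence x (suc t)) (suc i)  ≤⟨ +-mono-≤ (+≤+ t<ℓ) (sorted (gmSequence x (suc t)) p≤k) ⟩
    + ℓ + entries (gmSequence x (suc t)) k            ∎)
    where
    open ≤-Reasoning
    p≤k : Fin.suc i Fin.≤ k
    p≤k = subst (ℕ._< Fin.toℕ k) (Fin.toℕ-inject₁ i) q<k

lemma2 : (n ℓ : ℕ) .{{_ : NonZero n}} → 2 ℕ.≤ ℓ →
    (x⁰ : GMVector ℓ n) → range (entries x⁰) ≤ + ℓ →
    (j : ℕ) →
    position (pivot (gmSequence x⁰ j)) - position (pivot (gmSequence x⁰ (j ℕ.+ ℓ)))
    ≡ 1ℤ [mod n ]
lemma2 (suc m) ℓ@(suc _) _ x⁰ r j =
  -- The sequence is restarted at `xʲ`, where the range bound still holds.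
  subst (λ p → position (pivot xʲ) - position p ≡ 1ℤ [mod suc m ])
    (trans (sym (pivot-turn xʲ (gmSequence-range x⁰ r j))) (cong pivot (gmSequence-+ x⁰ j ℓ)))
    (position-cyclicPred (pivot xʲ))
  where
  xʲ : GMVector ℓ (suc m)
  xʲ = gmSequence x⁰ j
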